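{- Given a synchronous TeamLTL formula $\varphi$ over $\mathsf{AP}$ and a fresh proposition $o\notin\mathsf{AP}$, one can construct in time linear in $|\varphi|$ a formula $\varphi^+$ in $\exists\mathrm{TeamLTL}$ (respectively, in $\exists\mathrm{TeamCTL}(\vee_{\mathrm B})$) and a formula $\varphi^-$ in $\forall\mathrm{TeamLTL}(\vee_{\mathrm B},\mathrm{NE})$ (respectively, in $\forall\mathrm{TeamCTL}(\subseteq)$) such that for all multisets of traces $T$ over $\mathsf{AP}$: $$T\models_s\varphi\ \text{ iff }\ T_o\models_\exists\varphi^+\qquad\text{and}\qquad T\models_s\varphi\ \text{ iff }\ T_o\models_\forall\varphi^-.$$
   Context: A trace over $\mathsf{AP}$ is an infinite sequence $t\in(2^{\mathsf{AP}})^\omega$. A multiset is a set of pairs (index, element) with pairwise distinct indices (so an element may occur several times); the index is usually dropped. $T=T_1\uplus T_2$ means that $T$ is partitioned into $T_1$ and $T_2$ (either may be empty). For a multiset of traces $T$ over $\mathsf{AP}$ and $o\notin\mathsf{AP}$, $T_o$ is the multiset of traces over $\mathsf{AP}\uplus\{o\}$ obtained from $T$ by making $o$ true on each trace exactly at the even positions: $T_o=\{t\mid t{\upharpoonright}_{\mathsf{AP}}\in T\text{ and }(o\in t[i]\text{ iff }i\bmod 2=0)\}$, where $t{\upharpoonright}_{\mathsf{AP}}$ is the restriction of $t$ to $\mathsf{AP}$. Tefs: for a multiset of traces $T$ and $\tau\colon\mathbb N\times T\to\mathbb N$, write $\tau(i)=(\tau(i,t))_{t\in T}$; for tuples, $\vec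 a\le\vec b$ is componentwise, and $\vec a<\vec b$ means $\vec a\le\vec b$ and $\vec a\ne\vec b$. $\tau$ is a tef (time evaluation function) for $T$ if for all $i$: $\tau(i)<\tau(i+1)$ and $\tau(i)\le\tau(i+1)\le\tau(i)+\vec 1$; a stuttering tef if for all $i$: $\tau(i)\le\tau(i+1)\le\tau(i)+\vec 1$; a tef is synchronous if $\tau(i,t)=\tau(i,t')$ for all $i,t,t'$; it is initial if $\tau(0,t)=0$ for all $t$. TeamCTL$^*$ formulae: $\varphi ::= p\mid\neg p\mid(\varphi\lor\varphi)\mid(\varphi\land\varphi)\mid\mathsf X\varphi\mid[\varphi\,\mathsf U\,\varphi]\mid[\varphi\,\mathsf W\,\varphi]\mid\exists\varphi\mid\forall\varphi$. TeamLTL: the fragment without $\exists,\forall$. TeamCTL: the fragment in which each temporal operator directly follows a quantifier and vice versa (operators $\mathsf X_\exists,\mathsf X_\forall,\mathsf U_\exists,\mathsf U_\forall,\mathsf W_\exists,\mathsf W_\forall$, e.g. $\mathsf X_\forall\varphi=\forall\mathsf X\varphi$). $\exists$TeamCTL (resp. $\forall$TeamCTL): TeamCTL without the $\forall$-modalities (resp. $\exists$-modalities). Semantics, for $\tau$ a stuttering tef for $T$ and $i\in\mathbb N$: $(T,\tau,i)\models p$ iff $p\in t[\tau(i,t)]$ for all $t\in T$; $(T,\tau,i)\models\neg p$ iff $p\notin t[\tau(i,t)]$ for all $t\in T$; $\land$ is conjunction; $(T,\tau,i)\models(\varphi\lor\psi)$ iff there are $T_1\uplus T_2=T$ with $(T_1,\tau,i)\models\varphi$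 and $(T_2,\tau,i)\models\psi$ (with $\tau$ restricted accordingly); $(T,\tau,i)\models\mathsf X\varphi$ iff $(T,\tau,i+1)\models\varphi$; $(T,\tau,i)\models[\varphi\,\mathsf U\,\psi]$ iff there is $k\ge i$ with $(T,\tau,k)\models\psi$ and $(T,\tau,m)\models\varphi$ for all $i\le m<k$; $(T,\tau,i)\models[\varphi\,\mathsf W\,\psi]$ iff for all $k\ge i$, $(T,\tau,k)\models\varphi$ or there is $m$ with $i\le m\le k$ and $(T,\tau,m)\models\psi$; $(T,\tau,i)\models\exists\varphi$ (resp. $\forall\varphi$) iff $(T,\tau',i)\models\varphi$ for some (resp. all) tef(s) $\tau'$ for $T$ with $\tau'(j,t)=\tau(j,t)$ for all $j\le i$, $t\in T$. Extensions: $L(\mathcal C)$ is $L$ extended with the atoms and connectives in $\mathcal C$. Boolean disjunction $\vee_{\mathrm B}$ (distinct from $\lor$): $(T,\tau,i)\models(\varphi\vee_{\mathrm B}\psi)$ iff $(T,\tau,i)\models\varphi$ or $(T,\tau,i)\models\psi$. Non-emptiness: $(T,\tau,i)\models\mathrm{NE}$ iff $T\ne\emptyset$. Inclusion atom, for propositional formulae $\varphi_j,\psi_j$: $(T,\tau,i)\models\varphi_1,\dots,\varphi_n\subseteq\psi_1,\dots,\psi_n$ iff for all $t\in T$ there is $t'\in T$ such that for all $j$ the truth value of $\varphi_j$ at position $\tau(i,t)$ of $t$ equals that of $\psi_j$ at position $\tau(i,t')$ of $t'$. $T\models_\exists\varphi$ (resp. $T\models_\forall\varphi$) means $(T,\tau,0)\models\varphi$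 for some (resp. all) initial tef(s) $\tau$ for $T$. $T\models_s\varphi$ means $(T,\tau,0)\models\varphi$ for the unique initial synchronous tef $\tau$ for $T$. "Synchronous TeamLTL" is TeamLTL under $\models_s$; $\exists$TeamLTL and $\forall$TeamLTL are TeamLTL under $\models_\exists$ and $\models_\forall$.
   Formalization: The equivalence with T_o ⊨_∀ φ⁻ is stated for nonempty T only: the empty multiset has no tef, so T_o ⊨_∃ always fails and T_o ⊨_∀ always holds, and both equivalences cannot hold; T ⊨_s φ is read as "an initial synchronous tef exists and satisfies φ". -}

module Defs where

open import Level using (0ℓ)
open import Data.Bool using (Bool; true; false; not; _∧_; _∨_)
open import Data.Empty using (⊥; ⊥-elim)
open import Data.Fin using (Fin)
open import Data.List using (List; []; _∷_; [_]; _++_; length; fromMaybe)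
import Data.List as List
open import Data.Maybe using (Maybe; just; nothing)
import Data.Maybe as Maybe
open import Data.Nat using (ℕ; zero; suc; _+_; _*_; _%_; _≡ᵇ_; _≤_; _<_)
open import Data.Product using (Σ-syntax; ∃-syntax; _×_; _,_)
open import Data.Sum using (_⊎_)
open import Data.Unit using (⊤; tt)
open import Data.Vec using (Vec; []; _∷_; lookup)
import Data.Vec as Vec
open import Function using (id)
open import Relation.Binary.PropositionalEquality using (_≡_)
open import Relation.Nullary using (¬_)
open import Relation.Unary using (Pred; ∅)

-- Subsets, including the letters of 2^AP, are Boolean characteristic functions.

Subset : Set → Set
Subset A = A → Bool

_∈_ : {A : Set} → A → Subset A → Set
x ∈ S = S x ≡ true

_∉_ : {A : Set} → A → Subset A → Set
x ∉ S = S x ≡ false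

full : {A : Set} → Subset A
full _ = true

Partition : {A : Set} → Subset A → Subset A → Subset A → Set
Partition S S₁ S₂ = ∀ x → (S x ≡ S₁ x ∨ S₂ x) × (S₁ x ∧ S₂ x ≡ false)

Trace : Set → Set
Trace AP = ℕ → Subset AP

-- A set of pairs (index, element) with pairwise distinct indices is a family.

record Multiset (A : Set) : Set₁ where
  field
    Index   : Set
    element : Index → A

open Multiset public

Team : Set → Set₁
Team AP = Multiset (Trace AP)

NonEmpty : {AP : Set} → Team AP → Set
NonEmpty T = Index T

-- AP ⊎ {o} is Maybe AP, with o = nothing.  A trace t' over AP ⊎ {o} is determined
-- by its restriction to AP and by the positions of o, so T ₒ has exactly one
-- trace for every (indexed) trace of T.

_ₒ : {AP : Set} → Team AP → Team (Maybe AP)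
Index   (T ₒ)             = Index T
element (T ₒ) t i (just p) = element T t i p
element (T ₒ) t i nothing  = (i % 2) ≡ᵇ 0

infix 30 _ₒ

data Propositional (AP : Set) : Set where
  pos neg : AP → Propositional AP
  _or_    : Propositional AP → Propositional AP → Propositional AP
  _and_   : Propositional AP → Propositional AP → Propositional AP

eval : {AP : Set} → Propositional AP → Subset AP → Bool
eval (pos p)   a = a p
eval (neg p)   a = not (a p)
eval (φ or ψ)  a = eval φ a ∨ eval ψ a
eval (φ and ψ) a = eval φ a ∧ eval ψ a

data Quantifier : Set where
  some all : Quantifier

-- TeamCTL* together with all the extensions; fragments are predicates below.

data Formula (AP : Set) : Set where
  pos neg : AP → Formula AP
  _or_    : Formula AP → Formula AP → Formula AP
  _and_   : Formula AP → Formula AP → Formula AP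
  X       : Formula AP → Formula AP
  _U_     : Formula AP → Formula AP → Formula AP
  _W_     : Formula AP → Formula AP → Formula AP
  quant   : Quantifier → Formula AP → Formula AP
  _orᴮ_   : Formula AP → Formula AP → Formula AP
  NE      : Formula AP
  _⊆_     : ∀ {n} → Vec (Propositional AP) (suc n) → Vec (Propositional AP) (suc n) →
            Formula AP

data Extension : Set where
  ∨B ne incl : Extension

data TeamLTL {AP : Set} (𝒞 : Pred Extension 0ℓ) : Formula AP → Set where
  pos′  : ∀ p → TeamLTL 𝒞 (pos p)
  neg′  : ∀ p → TeamLTL 𝒞 (neg p)
  or′   : ∀ {φ ψ} → TeamLTL 𝒞 φ → TeamLTL 𝒞 ψ → TeamLTL 𝒞 (φ or ψ)
  and′  : ∀ {φ ψ} → TeamLTL 𝒞 φ → TeamLTL 𝒞 ψ → TeamLTL 𝒞 (φ and ψ)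
  X′    : ∀ {φ} → TeamLTL 𝒞 φ → TeamLTL 𝒞 (X φ)
  U′    : ∀ {φ ψ} → TeamLTL 𝒞 φ → TeamLTL 𝒞 ψ → TeamLTL 𝒞 (φ U ψ)
  W′    : ∀ {φ ψ} → TeamLTL 𝒞 φ → TeamLTL 𝒞 ψ → TeamLTL 𝒞 (φ W ψ)
  orᴮ′  : ∀ {φ ψ} → 𝒞 ∨B → TeamLTL 𝒞 φ → TeamLTL 𝒞 ψ → TeamLTL 𝒞 (φ orᴮ ψ)
  NE′   : 𝒞 ne → TeamLTL 𝒞 NE
  incl′ : ∀ {n} {φs ψs : Vec (Propositional AP) (suc n)} → 𝒞 incl → TeamLTL 𝒞 (φs ⊆ ψs)

-- 𝒬 is the set of admitted quantifiers: ∃TeamCTL is 𝒬 = ｛ some ｝, ∀TeamCTL is 𝒬 = ｛ all ｝.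

data TeamCTL {AP : Set} (𝒬 : Pred Quantifier 0ℓ) (𝒞 : Pred Extension 0ℓ) :
             Formula AP → Set where
  pos′  : ∀ p → TeamCTL 𝒬 𝒞 (pos p)
  neg′  : ∀ p → TeamCTL 𝒬 𝒞 (neg p)
  or′   : ∀ {φ ψ} → TeamCTL 𝒬 𝒞 φ → TeamCTL 𝒬 𝒞 ψ → TeamCTL 𝒬 𝒞 (φ or ψ)
  and′  : ∀ {φ ψ} → TeamCTL 𝒬 𝒞 φ → TeamCTL 𝒬 𝒞 ψ → TeamCTL 𝒬 𝒞 (φ and ψ)
  X′    : ∀ {Q φ} → 𝒬 Q → TeamCTL 𝒬 𝒞 φ → TeamCTL 𝒬 𝒞 (quant Q (X φ))
  U′    : ∀ {Q φ ψ} → 𝒬 Q → TeamCTL 𝒬 𝒞 φ → TeamCTL 𝒬 𝒞 ψ → TeamCTL 𝒬 𝒞 (quant Q (φ U ψ))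
  W′    : ∀ {Q φ ψ} → 𝒬 Q → TeamCTL 𝒬 𝒞 φ → TeamCTL 𝒬 𝒞 ψ → TeamCTL 𝒬 𝒞 (quant Q (φ W ψ))
  orᴮ′  : ∀ {φ ψ} → 𝒞 ∨B → TeamCTL 𝒬 𝒞 φ → TeamCTL 𝒬 𝒞 ψ → TeamCTL 𝒬 𝒞 (φ orᴮ ψ)
  NE′   : 𝒞 ne → TeamCTL 𝒬 𝒞 NE
  incl′ : ∀ {n} {φs ψs : Vec (Propositional AP) (suc n)} → 𝒞 incl → TeamCTL 𝒬 𝒞 (φs ⊆ ψs)

-- A submultiset of T is a subset S of Index T.  A time evaluation function for S
-- is represented by a function on all of Index T whose values outside S are never
-- inspected, so that restricting it to a smaller submultiset leaves it unchanged.

module Semantics {AP : Set} (T : Team AP) where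

  Sub : Set
  Sub = Subset (Index T)

  Tuple : Set
  Tuple = Index T → ℕ

  Times : Set
  Times = ℕ → Tuple

  _≤[_]_ _≈[_]_ _<[_]_ : Tuple → Sub → Tuple → Set
  a ≤[ S ] b = ∀ t → t ∈ S → a t ≤ b t
  a ≈[ S ] b = ∀ t → t ∈ S → a t ≡ b t
  a <[ S ] b = (a ≤[ S ] b) × ¬ (a ≈[ S ] b)

  +𝟏 : Tuple → Tuple
  +𝟏 a t = a t + 1

  StutteringTef : Sub → Times → Set
  StutteringTef S τ = ∀ i → (τ i ≤[ S ] τ (suc i)) × (τ (suc i) ≤[ S ] +𝟏 (τ i))

  Tef : Sub → Times → Set
  Tef S τ = (∀ i → τ i <[ S ] τ (suc i)) × StutteringTef S τ

  Synchronous : Sub → Times → Set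
  Synchronous S τ = ∀ i t t' → t ∈ S → t' ∈ S → τ i t ≡ τ i t'

  Initial : Sub → Times → Set
  Initial S τ = ∀ t → t ∈ S → τ 0 t ≡ 0

  Sat : Sub → Times → ℕ → Formula AP → Set
  Sat S τ i (pos p)   = ∀ t → t ∈ S → p ∈ element T t (τ i t)
  Sat S τ i (neg p)   = ∀ t → t ∈ S → p ∉ element T t (τ i t)
  Sat S τ i (φ or ψ)  = ∃[ S₁ ] ∃[ S₂ ] Partition S S₁ S₂ × Sat S₁ τ i φ × Sat S₂ τ i ψ
  Sat S τ i (φ and ψ) = Sat S τ i φ × Sat S τ i ψ
  Sat S τ i (X φ)     = Sat S τ (suc i) φ
  Sat S τ i (φ U ψ)   = ∃[ k ] i ≤ k × Sat S τ k ψ × (∀ m → i ≤ m → m < k → Sat S τ m φ)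
  Sat S τ i (φ W ψ)   = ∀ k → i ≤ k →
                        Sat S τ k φ ⊎ (∃[ m ] i ≤ m × m ≤ k × Sat S τ m ψ)
  Sat S τ i (quant some φ) =
    ∃[ τ' ] Tef S τ' × (∀ j → j ≤ i → τ' j ≈[ S ] τ j) × Sat S τ' i φ
  Sat S τ i (quant all φ)  =
    ∀ τ' → Tef S τ' → (∀ j → j ≤ i → τ' j ≈[ S ] τ j) → Sat S τ' i φ
  Sat S τ i (φ orᴮ ψ) = Sat S τ i φ ⊎ Sat S τ i ψ
  Sat S τ i NE        = ∃[ t ] t ∈ S
  Sat S τ i (φs ⊆ ψs) =
    ∀ t → t ∈ S → ∃[ t' ] t' ∈ S × (∀ j →
      eval (lookup φs j) (element T t (τ i t)) ≡ eval (lookup ψs j) (element T t' (τ i t')))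

-- An empty T has no tef at all (τ i <[ S ] τ (suc i) fails for empty S): then, for
-- every φ, T ⊨ₛ φ and T ⊨∃ φ fail while T ⊨∀ φ holds.  A nonempty T has exactly one
-- initial synchronous tef up to pointwise equality, namely τ i t = i.

infix 4 _⊨ₛ_ _⊨∃_ _⊨∀_

_⊨ₛ_ _⊨∃_ _⊨∀_ : {AP : Set} → Team AP → Formula AP → Set
T ⊨ₛ φ = ∃[ τ ] Tef full τ × Initial full τ × Synchronous full τ × Sat full τ 0 φ
  where open Semantics T
T ⊨∃ φ = ∃[ τ ] Tef full τ × Initial full τ × Sat full τ 0 φ
  where open Semantics T
T ⊨∀ φ = ∀ τ → Tef full τ → Initial full τ → Sat full τ 0 φ
  where open Semantics T

-- Formulae as words in prefix notation, which needs no parentheses.  Each side of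
-- an inclusion atom is closed by a separator.

data Keyword : Set where
  kneg kor kand kX kU kW korᴮ kNE kincl ksep : Keyword
  kquant : Quantifier → Keyword

data Token (A : Set) : Set where
  key  : Keyword → Token A
  prop : A → Token A

codeᴾ : {AP : Set} → Propositional AP → List (Token AP)
codeᴾ (pos p)   = [ prop p ]
codeᴾ (neg p)   = key kneg ∷ [ prop p ]
codeᴾ (φ or ψ)  = key kor ∷ codeᴾ φ ++ codeᴾ ψ
codeᴾ (φ and ψ) = key kand ∷ codeᴾ φ ++ codeᴾ ψ

codes : {AP : Set} {n : ℕ} → Vec (Propositional AP) n → List (Token AP)
codes []       = [ key ksep ]
codes (φ ∷ φs) = codeᴾ φ ++ codes φs

code : {AP : Set} → Formula AP → List (Token AP)
code (pos p)     = [ prop p ]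
code (neg p)     = key kneg ∷ [ prop p ]
code (φ or ψ)    = key kor ∷ code φ ++ code ψ
code (φ and ψ)   = key kand ∷ code φ ++ code ψ
code (X φ)       = key kX ∷ code φ
code (φ U ψ)     = key kU ∷ code φ ++ code ψ
code (φ W ψ)     = key kW ∷ code φ ++ code ψ
code (quant Q φ) = key (kquant Q) ∷ code φ
code (φ orᴮ ψ)   = key korᴮ ∷ code φ ++ code ψ
code NE          = [ key kNE ]
code (φs ⊆ ψs)   = key kincl ∷ codes φs ++ codes ψs

∣_∣ : {AP : Set} → Formula AP → ℕ
∣ φ ∣ = length (code φ)

-- Deterministic multitape Turing machines with a write-only output tape, uniform in
-- AP: the finite control recognises blanks and keywords, but of a proposition it
-- only sees that it is one, and can only copy it.  (For finite AP these are ordinary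
-- Turing machines over the alphabet of tokens.)  Outputs are words over AP ⊎ {o},
-- and the control may also print o.

Cell : Set → Set
Cell A = Maybe (Token A)

mapToken : {A B : Set} → (A → B) → Token A → Token B
mapToken f (key k)  = key k
mapToken f (prop p) = prop (f p)

mapCell : {A B : Set} → (A → B) → Cell A → Cell B
mapCell f = Maybe.map (mapToken f)

record Tape (A : Set) : Set where
  constructor tape
  field
    left  : List (Cell A)    -- nearest cell first
    head  : Cell A
    right : List (Cell A)

data Direction : Set where
  L S R : Direction

move : {A : Set} → Direction → Tape A → Tape A
move S t                     = t
move L (tape [] h rs)        = tape [] nothing (h ∷ rs)
move L (tape (l ∷ ls) h rs)  = tape ls l (h ∷ rs)
move R (tape ls h [])        = tape (h ∷ ls) nothing []
move R (tape ls h (r ∷ rs))  = tape (h ∷ ls) r rs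

write : {A : Set} → Cell A → Tape A → Tape A
write c (tape ls _ rs) = tape ls c rs

blankTape : {A : Set} → Tape A
blankTape = tape [] nothing []

load : {A : Set} → List (Token A) → Tape A
load []       = blankTape
load (x ∷ xs) = tape [] (just x) (List.map just xs)

-- What is written or printed: a fixed cell, or a copy of the cell under a head.
-- The only propositions that may occur in a fixed cell are those of F.

data Source (F : Set) (k : ℕ) : Set where
  fixed : Cell F → Source F k
  copy  : Fin k → Source F k

resolve : {F A B : Set} {k : ℕ} → (F → B) → (Cell A → Cell B) →
          Vec (Tape A) k → Source F k → Cell B
resolve f g ts (fixed c) = mapCell f c
resolve f g ts (copy h)  = g (Tape.head (lookup ts h))

record Action (states k : ℕ) : Set where
  constructor action
  field
    next   : Fin states
    writes : Vec (Source ⊥ k) k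
    moves  : Vec Direction k
    print  : Source ⊤ k         -- nothing is printed if this is blank

record Machine : Set where
  field
    states    : ℕ
    workTapes : ℕ

  tapes : ℕ
  tapes = suc workTapes

  field
    start : Fin states
    δ     : Fin states → Vec (Cell ⊤) tapes → Maybe (Action states tapes)  -- nothing: halt

module Execution (M : Machine) {AP : Set} where
  open Machine M
  open Action

  record Config : Set where
    constructor config
    field
      state    : Fin states
      contents : Vec (Tape AP) tapes

  open Config

  decision : Config → Maybe (Action states tapes)
  decision c = δ (state c) (Vec.map (λ t → mapCell (λ _ → tt) (Tape.head t)) (contents c))

  perform : Action states tapes → Config → Config
  perform a (config _ ts) =
    config (next a)
           (Vec.zipWith move (moves a)
             (Vec.zipWith write (Vec.map (resolve ⊥-elim id ts) (writes a)) ts))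

  printed : Action states tapes → Config → List (Token (Maybe AP))
  printed a c = fromMaybe (resolve (λ _ → nothing) (mapCell just) (contents c) (print a))

  -- Halts c n w: started in c, the machine halts after n steps, having printed w.

  data Halts (c : Config) : ℕ → List (Token (Maybe AP)) → Set where
    halt : decision c ≡ nothing → Halts c 0 []
    step : ∀ {a n w} → decision c ≡ just a → Halts (perform a c) n w →
           Halts c (suc n) (printed a c ++ w)

  initial : List (Token AP) → Config
  initial w = config start (load w ∷ Vec.replicate workTapes blankTape)

-- One machine, with one linear time bound, turns every TeamLTL formula φ over any AP
-- into a formula over AP ⊎ {o} related to φ by P.

LinearTimeConstruction : (∀ {AP : Set} → Formula AP → Formula (Maybe AP) → Set₁) → Set₁
LinearTimeConstruction P =
  Σ[ M ∈ Machine ] Σ[ c ∈ ℕ ]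
    (∀ {AP : Set} (φ : Formula AP) → TeamLTL ∅ φ →
      Σ[ φ' ∈ Formula (Maybe AP) ] Σ[ n ∈ ℕ ]
        n ≤ c * ∣ φ ∣ × Execution.Halts M (Execution.initial M (code φ)) n (code φ')
        × P φ φ')

{-# OPTIONS --safe #-}
module Submission where

-- The proposition o exposes the parity of the position of each trace.  A tef advances
-- every trace by 0 or 1 and some trace by 1, so if it was synchronous up to i, then it
-- is synchronous up to i + 1 iff the parities of all traces agree at i + 1.  Hence
-- "synchronous" means that no time is mixed, that is, has both parities present.
--   * ∃TeamLTL: G((o ∧ X¬o) ∨ (¬o ∧ Xo)) ∧ φ.
--   * ∃TeamCTL(∨ᴮ): (o ∨ᴮ ¬o) is added conjunctively to every subformula, so that
--     the tefs chosen by the modalities are synchronous as long as they matter.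
--   * ∀TeamLTL(∨ᴮ, NE): F((NE ∧ o) ∨ (NE ∧ ¬o)) ∨ᴮ φ.
--   * ∀TeamCTL(⊆): every subformula is joined by ∨ to the atom o ⊆ ¬o, which says
--     "empty or mixed".  On a synchronous team the part satisfying it must be empty, and
--     a mixed team satisfies every translated formula, so that an asynchronous tef
--     releases its U or W at its first mixed time.

open import Defs
open import Level using (0ℓ)
open import Axiom.ExcludedMiddle using (ExcludedMiddle)
open import Data.Bool using (Bool; true; false; not; _∧_; _∨_)
open import Data.Bool.Properties using (∨-identityʳ; ∧-zeroʳ; not-¬)
open import Data.Empty using (⊥; ⊥-elim)
open import Data.Fin using (Fin; zero; toℕ; fromℕ<)
open import Data.Fin.Properties using (toℕ-fromℕ<)
open import Data.List using (List; []; _∷_; _++_; length; drop; map)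
open import Data.List.Properties using (++-assoc; ++-identityʳ; length-++; length-drop; map-++; drop-all)
open import Data.Maybe using (Maybe; just; nothing)
open import Data.Nat using (ℕ; zero; suc; _+_; _*_; _%_; _≡ᵇ_; _≤_; _<_; _⊓_; z≤n; s≤s; s≤s⁻¹)
open import Data.Nat.Properties
open import Data.Product using (∃-syntax; _×_; _,_; proj₁; proj₂)
open import Data.Sum using (_⊎_; inj₁; inj₂; [_,_]′) renaming (map to ⊎-map)
open import Data.Unit using (⊤; tt)
open import Data.Vec using ([]; _∷_)
open import Function using (_∘_; id)
open import Function.Bundles using (_⇔_; mk⇔; Equivalence)
open import Relation.Binary.PropositionalEquality using (_≡_; refl; sym; trans; cong; subst; subst₂; module ≡-Reasoning)
open import Relation.Nullary using (¬_; Dec; yes; no)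
open import Relation.Unary using (∅; ｛_｝; _∪_)

open Equivalence using (to; from)

-- Parity and synchrony

even : ℕ → Bool
even n = (n % 2) ≡ᵇ 0

even-suc : ∀ n → even (suc n) ≡ not (even n)
even-suc 0             = refl
even-suc 1             = refl
even-suc (suc (suc n)) = even-suc n

even≢even-suc : ∀ n → ¬ (even n ≡ even (suc n))
even≢even-suc n e = not-¬ (sym e) (even-suc n)

-- Subteams, emptiness and partitions.

_⊑_ : {A : Set} → Subset A → Subset A → Set
V' ⊑ V = ∀ t → t ∈ V' → t ∈ V

Empty : {A : Set} → Subset A → Set
Empty V = ∀ t → t ∈ V → ⊥

∅-empty : {A : Set} → Empty {A} (λ _ → false)
∅-empty t ()

partition-⊑ˡ : ∀ {A} {V V₁ V₂ : Subset A} → Partition V V₁ V₂ → V₁ ⊑ V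
partition-⊑ˡ {V₂ = V₂} part t t∈V₁ = trans (proj₁ (part t)) (cong (_∨ V₂ t) t∈V₁)

partition-⊑ʳ : ∀ {A} {V V₁ V₂ : Subset A} → Partition V V₁ V₂ → V₂ ⊑ V
partition-⊑ʳ {V₁ = V₁} part t t∈V₂ with V₁ t | proj₁ (part t)
... | true  | e = e
... | false | e = trans e t∈V₂

partition-emptyˡ : ∀ {A} {V V₁ V₂ : Subset A} → Partition V V₁ V₂ → Empty V₁ → V ⊑ V₂
partition-emptyˡ {V₁ = V₁} part empty t t∈V with V₁ t in eq | proj₁ (part t)
... | true  | _ = ⊥-elim (empty t eq)
... | false | e = trans (sym e) t∈V

partition-with-empty : ∀ {A} {V V₂ : Subset A} → Empty V₂ → Partition V V V₂
partition-with-empty {V = V} {V₂} empty t with V₂ t in eq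
... | true  = ⊥-elim (empty t eq)
... | false = sym (∨-identityʳ (V t)) , ∧-zeroʳ (V t)

partition-restrict : ∀ {A} {V V₁ V₂ V' : Subset A} → V' ⊑ V → Partition V V₁ V₂ →
                     Partition V' (λ t → V' t ∧ V₁ t) (λ t → V' t ∧ V₂ t)
partition-restrict {V' = V'} V'⊑V part t with V' t in eq
... | false = refl , refl
... | true  = trans (sym (V'⊑V t eq)) (proj₁ (part t)) , proj₂ (part t)

partition-by : ∀ {A} (f : A → Bool) → Partition full f (λ t → not (f t))
partition-by f t with f t
... | true  = refl , refl
... | false = refl , refl

∧-trueˡ : ∀ {a b} → a ∧ b ≡ true → a ≡ true
∧-trueˡ {true} _ = refl

∧-trueʳ : ∀ {a b} → a ∧ b ≡ true → b ≡ true
∧-trueʳ {true} e = e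

not-true : ∀ {a} → not a ≡ true → a ≡ false
not-true {false} _ = refl

-- Tefs that are synchronous up to a given time.

module Synchrony {AP : Set} (T : Team AP) where
  open Semantics T

  clock : Times
  clock i t = i

  -- The whole history up to `i` is recorded because a quantifier at `i` fixes exactly that history:
  -- synchrony passes to every tef it ranges over, and on a nonempty team the clock is one of them.
  Synced : Sub → Times → ℕ → Set
  Synced V τ i = ∀ j → j ≤ i → ∀ t → t ∈ V → τ j t ≡ j

  Uniform Mixed : Sub → Times → ℕ → Set
  Uniform V τ i = ∀ t t' → t ∈ V → t' ∈ V → even (τ i t) ≡ even (τ i t')
  Mixed V τ i   = (∃[ t ] t ∈ V × even (τ i t) ≡ true) × (∃[ t ] t ∈ V × even (τ i t) ≡ false)

  synced-≤ : ∀ {V τ i j} → j ≤ i → Synced V τ i → Synced V τ j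
  synced-≤ j≤i s l l≤j = s l (≤-trans l≤j j≤i)

  synced-⊑ : ∀ {V V' τ i} → V' ⊑ V → Synced V τ i → Synced V' τ i
  synced-⊑ V'⊑V s j j≤i t = s j j≤i t ∘ V'⊑V t

  synced⇒¬mixed : ∀ {V τ i} → Synced V τ i → ¬ Mixed V τ i
  synced⇒¬mixed {i = i} s ((t , t∈V , e) , (t' , t'∈V , e'))
    with trans (sym e) (trans (cong even (trans (s i ≤-refl t t∈V) (sym (s i ≤-refl t' t'∈V)))) e')
  ... | ()

  -- Parities are Booleans, so two traces can be compared outright; a difference would exhibit a
  -- mixed time.
  ¬mixed⇒uniform : ∀ {V τ i} → ¬ Mixed V τ i → Uniform V τ i
  ¬mixed⇒uniform {τ = τ} {i} ¬mixed t t' t∈V t'∈V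
    with even (τ i t) in e | even (τ i t') in e'
  ... | true  | true  = refl
  ... | false | false = refl
  ... | true  | false = ⊥-elim (¬mixed ((t , t∈V , e) , (t' , t'∈V , e')))
  ... | false | true  = ⊥-elim (¬mixed ((t' , t'∈V , e') , (t , t∈V , e)))

  constant⇒uniform : ∀ {V τ i} b → (∀ t → t ∈ V → even (τ i t) ≡ b) → Uniform V τ i
  constant⇒uniform b c t t' t∈V t'∈V = trans (c t t∈V) (sym (c t' t'∈V))

  clock-synced : ∀ {V} i → Synced V clock i
  clock-synced i j _ t _ = refl

  clock-stuttering : ∀ {V} → StutteringTef V clock
  clock-stuttering i = (λ _ _ → n≤1+n i) , (λ _ _ → ≤-reflexive (+-comm 1 i))

  clock-tef : ∀ {V} → ¬ Empty V → Tef V clock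
  clock-tef nonempty =
      (λ i → proj₁ (clock-stuttering i) , λ same → nonempty (λ t t∈V → 1+n≢n (sym (same t t∈V))))
    , clock-stuttering

  tef⇒¬empty : ∀ {V τ} → Tef V τ → ¬ Empty V
  tef⇒¬empty (strict , _) empty = proj₂ (strict 0) (λ t t∈V → ⊥-elim (empty t t∈V))

  stays-or-advances : ∀ {V τ i t} → Tef V τ → Synced V τ i → t ∈ V →
                      τ (suc i) t ≡ i ⊎ τ (suc i) t ≡ suc i
  stays-or-advances {V} {τ} {i} {t} (_ , stutter) s t∈V =
    [ inj₁ ∘ (λ below → ≤-antisym below lower) , inj₂ ∘ ≤-antisym upper ]′ (≤-<-connex (τ (suc i) t) i)
    where
    lower : i ≤ τ (suc i) t
    lower = subst (_≤ τ (suc i) t) (s i ≤-refl t t∈V) (proj₁ (stutter i) t t∈V)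
    upper : τ (suc i) t ≤ suc i
    upper = subst (τ (suc i) t ≤_) (trans (cong (_+ 1) (s i ≤-refl t t∈V)) (+-comm i 1))
                  (proj₂ (stutter i) t t∈V)

  -- If one trace stays, then by uniform parity all stay, which no tef allows.
  advance : ∀ {V τ i} → Tef V τ → Synced V τ i → Uniform V τ (suc i) → Synced V τ (suc i)
  advance {V} {τ} {i} tef s uniform j j≤1+i t t∈V with m≤n⇒m<n∨m≡n j≤1+i
  ... | inj₁ j<1+i = s j (s≤s⁻¹ j<1+i) t t∈V
  ... | inj₂ refl with stays-or-advances tef s t∈V
  ...   | inj₂ advances = advances
  ...   | inj₁ stays    = ⊥-elim (proj₂ (proj₁ tef i) all-stay)
    where
    all-stay : τ i ≈[ V ] τ (suc i)
    all-stay t' t'∈V with stays-or-advances tef s t'∈V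
    ... | inj₁ stays'   = trans (s i ≤-refl t' t'∈V) (sym stays')
    ... | inj₂ advances = ⊥-elim (even≢even-suc i
            (subst₂ (λ x y → even x ≡ even y) stays advances (uniform t t' t∈V t'∈V)))

  -- Induction on `k`, extending synchrony one step at a time by `advance`. `P` is an excuse for
  -- stopping; the `m` returned is the first one at which `step` offers it, so synchrony still
  -- reaches up to `m`.
  synced-until : ∀ {V τ i} (P : ℕ → Set) → Tef V τ → Synced V τ i → ∀ k →
                 (∀ m → i ≤ m → m < k → Uniform V τ (suc m) ⊎ P m) →
                 Synced V τ k ⊎ (∃[ m ] i ≤ m × m < k × Synced V τ m × P m)
  synced-until P tef s zero    step = inj₁ (synced-≤ z≤n s)
  synced-until {i = i} P tef s (suc k) step
    with synced-until P tef s k (λ m i≤m m<k → step m i≤m (m<n⇒m<1+n m<k))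
  ... | inj₂ (m , i≤m , m<k , found) = inj₂ (m , i≤m , m<n⇒m<1+n m<k , found)
  ... | inj₁ sₖ with ≤-<-connex i k
  -- Here `suc k ≤ i`, so the assumed synchrony up to `i` already covers it.
  ...   | inj₂ k<i = inj₁ (synced-≤ k<i s)
  ...   | inj₁ i≤k with step k i≤k ≤-refl
  ...     | inj₁ uniform = inj₁ (advance tef sₖ uniform)
  ...     | inj₂ p       = inj₂ (k , i≤k , ≤-refl , sₖ , p)

  always-synced : ∀ {V τ} → Tef V τ → Synced V τ 0 → (∀ m → Synced V τ m → Uniform V τ (suc m)) →
                  ∀ k → Synced V τ k
  always-synced tef s uniform zero    = s
  always-synced tef s uniform (suc k) =
    let sₖ = always-synced tef s uniform k in advance tef sₖ (uniform k sₖ)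

  initial⇒synced : ∀ {V τ} → Initial V τ → Synced V τ 0
  initial⇒synced init zero z≤n = init

  -- The empty team property of plain TeamLTL. It settles the case of an empty subteam, which has no
  -- tef, so that existential quantifiers fail on it and universal ones hold vacuously.
  Sat-empty : ∀ {φ V τ i} → TeamLTL ∅ φ → Empty V → Sat V τ i φ
  Sat-empty (pos′ p)  empty t t∈V = ⊥-elim (empty t t∈V)
  Sat-empty (neg′ p)  empty t t∈V = ⊥-elim (empty t t∈V)
  Sat-empty (or′ d e) empty =
    _ , _ , partition-with-empty ∅-empty , Sat-empty d empty , Sat-empty e ∅-empty
  Sat-empty (and′ d e) empty = Sat-empty d empty , Sat-empty e empty
  Sat-empty (X′ d)     empty = Sat-empty d empty
  Sat-empty (U′ d e)   empty = _ , ≤-refl , Sat-empty e empty , λ _ _ _ → Sat-empty d empty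
  Sat-empty (W′ d e)   empty k _ = inj₁ (Sat-empty d empty)

  -- Downward closure of plain TeamLTL, proved together with invariance under changing the times
  -- outside the smaller team; there the two time functions agree only pointwise.
  Sat-mono : ∀ {φ V V' τ τ' i} → TeamLTL ∅ φ → V' ⊑ V → (∀ j → τ j ≈[ V' ] τ' j) →
             Sat V τ i φ → Sat V' τ' i φ
  Sat-mono (pos′ p) sub same sat t t∈V' =
    subst (λ j → p ∈ element T t j) (same _ t t∈V') (sat t (sub t t∈V'))
  Sat-mono (neg′ p) sub same sat t t∈V' =
    subst (λ j → p ∉ element T t j) (same _ t t∈V') (sat t (sub t t∈V'))
  Sat-mono {V' = V'} (or′ d e) sub same (V₁ , V₂ , part , sat₁ , sat₂) =
    _ , _ , partition-restrict sub part
      , Sat-mono d (λ t → ∧-trueʳ) (λ j t → same j t ∘ ∧-trueˡ) sat₁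
      , Sat-mono e (λ t → ∧-trueʳ) (λ j t → same j t ∘ ∧-trueˡ) sat₂
  Sat-mono (and′ d e) sub same (sat₁ , sat₂) = Sat-mono d sub same sat₁ , Sat-mono e sub same sat₂
  Sat-mono (X′ d) sub same sat = Sat-mono d sub same sat
  Sat-mono (U′ d e) sub same (k , i≤k , satₖ , before) =
    k , i≤k , Sat-mono e sub same satₖ , λ m i≤m m<k → Sat-mono d sub same (before m i≤m m<k)
  Sat-mono (W′ d e) sub same sat k i≤k with sat k i≤k
  ... | inj₁ satₖ                     = inj₁ (Sat-mono d sub same satₖ)
  ... | inj₂ (m , i≤m , m≤k , satₘ) = inj₂ (m , i≤m , m≤k , Sat-mono e sub same satₘ)

  -- A synchronous tef has uniform parity at every time, so `always-synced` identifies it with the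
  -- clock. The conjunct `Tef full clock` records that the team is not empty.
  ⊨ₛ⇔clock : ∀ {φ} → TeamLTL ∅ φ → (T ⊨ₛ φ) ⇔ (Tef full clock × Sat full clock 0 φ)
  ⊨ₛ⇔clock {φ} d = mk⇔ forth (λ (tef , sat) → clock , tef , (λ _ _ → refl) , (λ _ _ _ _ _ → refl) , sat)
    where
    forth : T ⊨ₛ φ → Tef full clock × Sat full clock 0 φ
    forth (τ , tef , init , sync , sat) = clock-tef (tef⇒¬empty tef) ,
      Sat-mono d (λ _ → id) (λ j → synced j j ≤-refl) sat
      where
      synced : ∀ k → Synced full τ k
      synced = always-synced tef (initial⇒synced init)
        (λ m _ t t' t∈ t'∈ → cong even (sync (suc m) t t' t∈ t'∈))

-- Translations

-- `con` is the context put around every subformula and `temp` the one put around a temporal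
-- operator inside `con`. The recursion runs over the `TeamLTL ∅` derivation, so only plain formulae
-- need clauses.
module Translation {AP : Set} (con temp : Formula (Maybe AP) → Formula (Maybe AP)) where

  translate body : ∀ {φ : Formula AP} → TeamLTL ∅ φ → Formula (Maybe AP)
  translate d = con (body d)
  body (pos′ p)   = pos (just p)
  body (neg′ p)   = neg (just p)
  body (or′ d e)  = translate d or translate e
  body (and′ d e) = translate d and translate e
  body (X′ d)     = temp (X (translate d))
  body (U′ d e)   = temp (translate d U translate e)
  body (W′ d e)   = temp (translate d W translate e)

module Correctness {AP : Set} (T : Team AP) where
  open Semantics T
  open Synchrony T
  open Semantics (T ₒ) using () renaming (Sat to Satₒ)

  -- Valid V τ i stands for how far τ is known to be synchronous on V when a formula is
  -- evaluated at i.
  Faithful : (Sub → Times → ℕ → Set) → Formula (Maybe AP) → Formula AP → Set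
  Faithful Valid F φ = ∀ {V τ i} → Valid V τ i → Satₒ V τ i F ⇔ Sat V clock i φ

  module _ (Valid : Sub → Times → ℕ → Set)
           (con temp : Formula (Maybe AP) → Formula (Maybe AP)) where
    open Translation con temp

    -- The induction shared by all translations. Literals need only that `τ i` is `i` on the team,
    -- and splits only that validity passes to subteams, with the same partition on both sides; the
    -- rest is left to each translation.
    translate-faithful :
      (∀ {V V' τ i} → V' ⊑ V → Valid V τ i → Valid V' τ i) →
      (∀ {V τ i} → Valid V τ i → ∀ t → t ∈ V → τ i t ≡ i) →
      (∀ F {φ} → TeamLTL ∅ φ → Faithful Valid F φ → Faithful Valid (con F) φ) →
      (∀ F {φ} → TeamLTL ∅ φ → Faithful Valid (con F) φ →
        Faithful Valid (temp (X (con F))) (X φ)) →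
      (∀ F G {φ ψ} → TeamLTL ∅ φ → TeamLTL ∅ ψ → Faithful Valid (con F) φ →
        Faithful Valid (con G) ψ → Faithful Valid (temp (con F U con G)) (φ U ψ)) →
      (∀ F G {φ ψ} → TeamLTL ∅ φ → TeamLTL ∅ ψ → Faithful Valid (con F) φ →
        Faithful Valid (con G) ψ → Faithful Valid (temp (con F W con G)) (φ W ψ)) →
      ∀ {φ} (d : TeamLTL ∅ φ) → Faithful Valid (translate d) φ
    translate-faithful mono now con-f X-f U-f W-f = translated
      where
      translated : ∀ {φ} (d : TeamLTL ∅ φ) → Faithful Valid (translate d) φ
      bodily     : ∀ {φ} (d : TeamLTL ∅ φ) → Faithful Valid (body d) φ
      translated d = con-f (body d) d (bodily d)
      bodily (pos′ p) valid = mk⇔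
        (λ sat t t∈V → subst (λ j → p ∈ element T t j) (now valid t t∈V) (sat t t∈V))
        (λ sat t t∈V → subst (λ j → p ∈ element T t j) (sym (now valid t t∈V)) (sat t t∈V))
      bodily (neg′ p) valid = mk⇔
        (λ sat t t∈V → subst (λ j → p ∉ element T t j) (now valid t t∈V) (sat t t∈V))
        (λ sat t t∈V → subst (λ j → p ∉ element T t j) (sym (now valid t t∈V)) (sat t t∈V))
      bodily (or′ d e) valid = mk⇔
        (λ (V₁ , V₂ , part , sat₁ , sat₂) → V₁ , V₂ , part
          , to (translated d (mono (partition-⊑ˡ part) valid)) sat₁
          , to (translated e (mono (partition-⊑ʳ part) valid)) sat₂)
        (λ (V₁ , V₂ , part , sat₁ , sat₂) → V₁ , V₂ , part
          , from (translated d (mono (partition-⊑ˡ part) valid)) sat₁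
          , from (translated e (mono (partition-⊑ʳ part) valid)) sat₂)
      bodily (and′ d e) valid = mk⇔
        (λ (sat₁ , sat₂) → to (translated d valid) sat₁ , to (translated e valid) sat₂)
        (λ (sat₁ , sat₂) → from (translated d valid) sat₁ , from (translated e valid) sat₂)
      bodily (X′ d)   = X-f (body d) d (translated d)
      bodily (U′ d e) = U-f (body d) (body e) d e (translated d) (translated e)
      bodily (W′ d e) = W-f (body d) (body e) d e (translated d) (translated e)

-- The plain embedding used by both TeamLTL translations.

module Embedding {AP : Set} where
  open Translation {AP} id id public renaming (translate to embed)

  embed-TeamLTL : ∀ {𝒞 φ} (d : TeamLTL ∅ φ) → TeamLTL 𝒞 (embed d)
  embed-TeamLTL (pos′ p)   = pos′ (just p)
  embed-TeamLTL (neg′ p)   = neg′ (just p)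
  embed-TeamLTL (or′ d e)  = or′ (embed-TeamLTL d) (embed-TeamLTL e)
  embed-TeamLTL (and′ d e) = and′ (embed-TeamLTL d) (embed-TeamLTL e)
  embed-TeamLTL (X′ d)     = X′ (embed-TeamLTL d)
  embed-TeamLTL (U′ d e)   = U′ (embed-TeamLTL d) (embed-TeamLTL e)
  embed-TeamLTL (W′ d e)   = W′ (embed-TeamLTL d) (embed-TeamLTL e)

  module _ (T : Team AP) where
    open Semantics T
    open Synchrony T
    open Correctness T

    -- No quantifier ever changes `τ`, so validity can demand synchrony at all times, independently
    -- of the current one.
    embed-faithful : ∀ {φ} (d : TeamLTL ∅ φ) → Faithful (λ V τ _ → ∀ k → Synced V τ k) (embed d) φ
    embed-faithful = translate-faithful _ id id
      (λ sub s k → synced-⊑ sub (s k))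
      (λ {_} {_} {i} s → s i i ≤-refl)
      (λ _ _ f → f)
      (λ _ _ f → f)
      (λ _ _ _ _ f g s → mk⇔
        (λ (k , i≤k , satₖ , before) → k , i≤k , to (g s) satₖ , λ m i≤m m<k → to (f s) (before m i≤m m<k))
        (λ (k , i≤k , satₖ , before) → k , i≤k , from (g s) satₖ , λ m i≤m m<k → from (f s) (before m i≤m m<k)))
      (λ _ _ _ _ f g s → mk⇔
        (λ sat k i≤k → ⊎-map (to (f s)) (λ (m , i≤m , m≤k , satₘ) → m , i≤m , m≤k , to (g s) satₘ) (sat k i≤k))
        (λ sat k i≤k → ⊎-map (from (f s)) (λ (m , i≤m , m≤k , satₘ) → m , i≤m , m≤k , from (g s) satₘ) (sat k i≤k)))

-- The translation into ∃TeamLTL.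

module ∃LTL {AP : Set} where
  open Embedding {AP}

  o ō flips : Formula (Maybe AP)
  o     = pos nothing
  ō     = neg nothing
  flips = (o and X ō) or (ō and X o)

  -- `o and ō` holds on the empty team only, so on a nonempty team this `W` says that `flips` always
  -- holds.
  outer : Formula (Maybe AP) → Formula (Maybe AP)
  outer F = (flips W (o and ō)) and F

  fragment : ∀ {φ} (d : TeamLTL ∅ φ) → TeamLTL ∅ (outer (embed d))
  fragment d = and′
    (W′ (or′ (and′ (pos′ _) (X′ (neg′ _))) (and′ (neg′ _) (X′ (pos′ _)))) (and′ (pos′ _) (neg′ _)))
    (embed-TeamLTL d)

  module _ (T : Team AP) where
    open Semantics T
    open Synchrony T
    open Semantics (T ₒ) using () renaming (Sat to Satₒ)

    flips⇒parity : ∀ {V τ i} → Satₒ V τ i flips → ∀ t → t ∈ V → even (τ (suc i) t) ≡ not (even (τ i t))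
    flips⇒parity (V₁ , V₂ , part , (ev , od) , (od' , ev')) t t∈V with V₁ t in e₁ | V₂ t in e₂ | proj₁ (part t)
    ... | true  | _     | _ = trans (od t e₁) (cong not (sym (ev t e₁)))
    ... | false | true  | _ = trans (ev' t e₂) (cong not (sym (od' t e₂)))
    ... | false | false | e with trans (sym t∈V) e
    ...   | ()

    clock-flips : ∀ i → Satₒ full clock i flips
    -- On the clock all traces have the parity of `i`, so one part is the whole team and the other
    -- is empty.
    clock-flips i = _ , _ , partition-by (λ _ → even i)
      , ((λ t e → e) , (λ t e → trans (even-suc i) (cong not e)))
      , ((λ t e → not-true e) , (λ t e → trans (even-suc i) e))

    correct : ∀ {φ} (d : TeamLTL ∅ φ) → (T ⊨ₛ φ) ⇔ (T ₒ ⊨∃ outer (embed d))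
    correct {φ} d = mk⇔ forth back
      where
      forth : T ⊨ₛ φ → T ₒ ⊨∃ outer (embed d)
      forth sat with to (⊨ₛ⇔clock d) sat
      ... | tef , sat' = clock , tef , (λ _ _ → refl) , (λ k _ → inj₁ (clock-flips k))
                       , from (embed-faithful T d clock-synced) sat'

      back : T ₒ ⊨∃ outer (embed d) → T ⊨ₛ φ
      back (τ , tef , init , always , sat) = from (⊨ₛ⇔clock d)
        (clock-tef (tef⇒¬empty tef) , to (embed-faithful T d synced) sat)
        where
        parity : ∀ i t → t ∈ full → even (τ (suc i) t) ≡ not (even (τ i t))
        parity i t t∈ with always i z≤n
        ... | inj₁ satᵢ                      = flips⇒parity {full} {τ} {i} satᵢ t t∈
        -- A release of the `W` would give the trace `t` both parities at time `m`.
        ... | inj₂ (m , _ , _ , (ev , od)) with trans (sym (ev t t∈)) (od t t∈)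
        ...   | ()

        synced : ∀ k → Synced full τ k
        synced = always-synced tef (initial⇒synced init) λ m s → constant⇒uniform {τ = τ} {suc m} (not (even m))
          (λ t t∈ → trans (parity m t t∈) (cong (not ∘ even) (s m ≤-refl t t∈)))

-- The translation into ∃TeamCTL with Boolean disjunction.

module ∃CTL {AP : Set} where

  o ō : Formula (Maybe AP)
  o = pos nothing
  ō = neg nothing

  -- The empty team has no tef, so existential modalities fail on it.
  con temp : Formula (Maybe AP) → Formula (Maybe AP)
  con F  = (o orᴮ ō) and F
  temp F = (o and ō) orᴮ quant some F

  open Translation con temp public

  con-fragment : ∀ {F} → TeamCTL ｛ some ｝ ｛ ∨B ｝ F → TeamCTL ｛ some ｝ ｛ ∨B ｝ (con F)
  con-fragment = and′ (orᴮ′ refl (pos′ _) (neg′ _))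

  temp-fragment : ∀ {F} → TeamCTL ｛ some ｝ ｛ ∨B ｝ (quant some F) → TeamCTL ｛ some ｝ ｛ ∨B ｝ (temp F)
  temp-fragment = orᴮ′ refl (and′ (pos′ _) (neg′ _))

  fragment : ∀ {φ} (d : TeamLTL ∅ φ) → TeamCTL ｛ some ｝ ｛ ∨B ｝ (translate d)
  fragment (pos′ p)   = con-fragment (pos′ (just p))
  fragment (neg′ p)   = con-fragment (neg′ (just p))
  fragment (or′ d e)  = con-fragment (or′ (fragment d) (fragment e))
  fragment (and′ d e) = con-fragment (and′ (fragment d) (fragment e))
  fragment (X′ d)     = con-fragment (temp-fragment (X′ refl (fragment d)))
  fragment (U′ d e)   = con-fragment (temp-fragment (U′ refl (fragment d) (fragment e)))
  fragment (W′ d e)   = con-fragment (temp-fragment (W′ refl (fragment d) (fragment e)))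

  module _ (em : ExcludedMiddle 0ℓ) (T : Team AP) where
    open Semantics T
    open Synchrony T
    open Correctness T
    open Semantics (T ₒ) using () renaming (Sat to Satₒ)

    -- This supplies the uniformity with which `advance` carries synchrony along a tef chosen by a
    -- modality.
    con⇒uniform : ∀ {V τ i F} → Satₒ V τ i (con F) → Uniform V τ i
    con⇒uniform {τ = τ} {i} (inj₁ ev , _) = constant⇒uniform {τ = τ} {i} true ev
    con⇒uniform {τ = τ} {i} (inj₂ od , _) = constant⇒uniform {τ = τ} {i} false od

    con-faithful : ∀ F {φ} → TeamLTL ∅ φ → Faithful Synced F φ → Faithful Synced (con F) φ
    con-faithful F d f {V} {τ} {i} s = mk⇔ (to (f s) ∘ proj₂) (λ sat → uniform , from (f s) sat)
      where
      uniform : Satₒ V τ i (o orᴮ ō)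
      uniform with even i in e
      ... | true  = inj₁ (λ t t∈V → trans (cong even (s i ≤-refl t t∈V)) e)
      ... | false = inj₂ (λ t t∈V → trans (cong even (s i ≤-refl t t∈V)) e)

    -- A tef chosen at `i` inherits the synchrony of `τ` up to `i`, which is what `there` starts
    -- from. Conversely the clock serves as the witness, unless the team is empty; then the disjunct
    -- `o and ō` applies.
    temp-faithful : ∀ F {φ} → TeamLTL ∅ φ →
      (∀ {V τ i} → Tef V τ → Synced V τ i → Satₒ V τ i F → Sat V clock i φ) →
      (∀ {V i} → Sat V clock i φ → Satₒ V clock i F) →
      Faithful Synced (temp F) φ
    temp-faithful F {φ} d there back {V} {τ} {i} s = mk⇔ forth (backward em)
      where
      forth : Satₒ V τ i (temp F) → Sat V clock i φ
      forth (inj₁ (ev , od)) = Sat-empty d λ t t∈V → true≢false (trans (sym (ev t t∈V)) (od t t∈V))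
        where
        true≢false : ¬ (true ≡ false)
        true≢false ()
      forth (inj₂ (τ' , tef , same , sat)) =
        there tef (λ j j≤i t t∈V → trans (same j j≤i t t∈V) (s j j≤i t t∈V)) sat

      backward : Dec (Empty V) → Sat V clock i φ → Satₒ V τ i (temp F)
      backward (yes empty)   sat = inj₁ ((λ t t∈V → ⊥-elim (empty t t∈V)) , (λ t t∈V → ⊥-elim (empty t t∈V)))
      backward (no nonempty) sat =
        inj₂ (clock , clock-tef nonempty , (λ j j≤i t t∈V → sym (s j j≤i t t∈V)) , back sat)

    X-faithful : ∀ F {φ} → TeamLTL ∅ φ → Faithful Synced (con F) φ →
                 Faithful Synced (temp (X (con F))) (X φ)
    X-faithful F d f = temp-faithful (X (con F)) (X′ d)
      (λ {V} {τ} {i} tef s sat → to (f (advance tef s (con⇒uniform {V} {τ} {suc i} {F} sat))) sat)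
      (λ {_} {i} → from (f (clock-synced (suc i))))

    U-faithful : ∀ F G {φ ψ} → TeamLTL ∅ φ → TeamLTL ∅ ψ →
                 Faithful Synced (con F) φ → Faithful Synced (con G) ψ →
                 Faithful Synced (temp (con F U con G)) (φ U ψ)
    U-faithful F G {φ} {ψ} d e f g = temp-faithful (con F U con G) (U′ d e) there
      (λ (k , i≤k , satₖ , before) → k , i≤k , from (g (clock-synced k)) satₖ ,
        λ m i≤m m<k → from (f (clock-synced m)) (before m i≤m m<k))
      where
      there : ∀ {V τ i} → Tef V τ → Synced V τ i → Satₒ V τ i (con F U con G) → Sat V clock i (φ U ψ)
      there {V} {τ} {i} tef s (k , i≤k , satₖ , before) =
        k , i≤k , to (g sₖ) satₖ , λ m i≤m m<k → to (f (synced-≤ (<⇒≤ m<k) sₖ)) (before m i≤m m<k)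
        where
        -- The parity at `suc m` is controlled by the guard of the left argument before `k`, and by
        -- that of the right argument at `k`.
        uniform : ∀ m → i ≤ m → m < k → Uniform V τ (suc m)
        uniform m i≤m m<k with m≤n⇒m<n∨m≡n m<k
        ... | inj₁ 1+m<k = con⇒uniform {V} {τ} {suc m} {F} (before (suc m) (m≤n⇒m≤1+n i≤m) 1+m<k)
        ... | inj₂ refl  = con⇒uniform {V} {τ} {k} {G} satₖ

        sₖ : Synced V τ k
        sₖ with synced-until (λ _ → ⊥) tef s k (λ m i≤m m<k → inj₁ (uniform m i≤m m<k))
        ... | inj₁ s' = s'

    W-faithful : ∀ F G {φ ψ} → TeamLTL ∅ φ → TeamLTL ∅ ψ →
                 Faithful Synced (con F) φ → Faithful Synced (con G) ψ →
                 Faithful Synced (temp (con F W con G)) (φ W ψ)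
    W-faithful F G {φ} {ψ} d e f g = temp-faithful (con F W con G) (W′ d e) there
      (λ sat k i≤k → ⊎-map (from (f (clock-synced k)))
        (λ (m , i≤m , m≤k , satₘ) → m , i≤m , m≤k , from (g (clock-synced m)) satₘ) (sat k i≤k))
      where
      there : ∀ {V τ i} → Tef V τ → Synced V τ i → Satₒ V τ i (con F W con G) → Sat V clock i (φ W ψ)
      there {V} {τ} {i} tef s sat k i≤k with synced-until Released tef s k released
        where
        -- A release at `n ≤ m` falls within the synchronous range and ends the search. A release
        -- exactly at `suc m` instead yields uniformity there, through the guard of `con G`, and the
        -- search goes on.
        Released : ℕ → Set
        Released m = ∃[ n ] i ≤ n × n ≤ m × Satₒ V τ n (con G)

        released : ∀ m → i ≤ m → m < k → Uniform V τ (suc m) ⊎ Released m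
        released m i≤m m<k with sat (suc m) (m≤n⇒m≤1+n i≤m)
        ... | inj₁ satₘ = inj₁ (con⇒uniform {V} {τ} {suc m} {F} satₘ)
        ... | inj₂ (n , i≤n , n≤1+m , satₙ) with m≤n⇒m<n∨m≡n n≤1+m
        ...   | inj₁ n<1+m = inj₂ (n , i≤n , s≤s⁻¹ n<1+m , satₙ)
        ...   | inj₂ refl  = inj₁ (con⇒uniform {V} {τ} {suc m} {G} satₙ)
      ... | inj₂ (m , i≤m , m<k , sₘ , n , i≤n , n≤m , satₙ) =
        inj₂ (n , i≤n , ≤-trans n≤m (<⇒≤ m<k) , to (g (synced-≤ n≤m sₘ)) satₙ)
      ... | inj₁ sₖ with sat k i≤k
      ...   | inj₁ satₖ = inj₁ (to (f sₖ) satₖ)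
      ...   | inj₂ (n , i≤n , n≤k , satₙ) = inj₂ (n , i≤n , n≤k , to (g (synced-≤ n≤k sₖ)) satₙ)

    faithful : ∀ {φ} (d : TeamLTL ∅ φ) → Faithful Synced (translate d) φ
    faithful = translate-faithful Synced con temp synced-⊑ (λ {_} {_} {i} s → s i ≤-refl)
      con-faithful X-faithful U-faithful W-faithful

    correct : ∀ {φ} (d : TeamLTL ∅ φ) → (T ⊨ₛ φ) ⇔ (T ₒ ⊨∃ translate d)
    correct {φ} d = mk⇔ forth
      (λ (τ , tef , init , sat) → from (⊨ₛ⇔clock d)
        (clock-tef (tef⇒¬empty tef) , to (faithful d (initial⇒synced init)) sat))
      where
      forth : T ⊨ₛ φ → T ₒ ⊨∃ translate d
      forth sat with to (⊨ₛ⇔clock d) sat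
      ... | tef , sat' = clock , tef , (λ _ _ → refl) , from (faithful d (clock-synced 0)) sat'

-- The translation into ∀TeamLTL with Boolean disjunction and non-emptiness.

module ∀LTL {AP : Set} where
  open Embedding {AP}

  o ō mixed : Formula (Maybe AP)
  o     = pos nothing
  ō     = neg nothing
  mixed = (NE and o) or (NE and ō)

  -- `o or ō` holds on every team, split by parity, so this `U` says that a mixed time eventually
  -- occurs.
  outer : Formula (Maybe AP) → Formula (Maybe AP)
  outer F = ((o or ō) U mixed) orᴮ F

  fragment : ∀ {φ} (d : TeamLTL ∅ φ) → TeamLTL (｛ ∨B ｝ ∪ ｛ ne ｝) (outer (embed d))
  fragment d = orᴮ′ (inj₁ refl)
    (U′ (or′ (pos′ _) (neg′ _))
        (or′ (and′ (NE′ (inj₂ refl)) (pos′ _)) (and′ (NE′ (inj₂ refl)) (neg′ _))))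
    (embed-TeamLTL d)

  module _ (em : ExcludedMiddle 0ℓ) (T : Team AP) where
    open Semantics T
    open Synchrony T
    open Semantics (T ₒ) using () renaming (Sat to Satₒ)

    Sat-mixed : ∀ τ i → Satₒ full τ i mixed ⇔ Mixed full τ i
    Sat-mixed τ i = mk⇔
      (λ (V₁ , V₂ , part , ((t , t∈) , ev) , ((t' , t'∈) , od)) →
        (t , refl , ev t t∈) , (t' , refl , od t' t'∈))
      (λ ((t , _ , e) , (t' , _ , e')) → _ , _ , partition-by (λ t → even (τ i t))
        , ((t , e) , (λ _ → id)) , ((t' , cong not e') , (λ _ → not-true)))

    -- Excluded middle decides whether `τ` ever has a mixed time; if not, it is synchronous
    -- throughout. Conversely the clock, a tef because the team is nonempty, is never mixed and must
    -- satisfy the second disjunct.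
    correct : ∀ {φ} (d : TeamLTL ∅ φ) → NonEmpty T → (T ⊨ₛ φ) ⇔ (T ₒ ⊨∀ outer (embed d))
    correct {φ} d t₀ = mk⇔ (λ sat τ tef init → forth sat τ tef init em) back
      where
      forth : T ⊨ₛ φ → ∀ τ → Tef full τ → Initial full τ → Dec (∃[ i ] Mixed full τ i) →
              Satₒ full τ 0 (outer (embed d))
      forth _ τ tef init (yes (k , mix)) = inj₁ (k , z≤n , from (Sat-mixed τ k) mix ,
        λ m _ _ → _ , _ , partition-by (λ t → even (τ m t)) , (λ _ → id) , (λ _ → not-true))
      forth sat τ tef init (no ¬mixed) = inj₂ (from (embed-faithful T d synced) (proj₂ (to (⊨ₛ⇔clock d) sat)))
        where
        synced : ∀ k → Synced full τ k
        synced = always-synced tef (initial⇒synced init)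
          (λ m _ → ¬mixed⇒uniform {τ = τ} {suc m} (λ mix → ¬mixed (suc m , mix)))

      nonempty : ¬ Empty {Index T} full
      nonempty empty = empty t₀ refl

      back : T ₒ ⊨∀ outer (embed d) → T ⊨ₛ φ
      back sat with sat clock (clock-tef nonempty) (λ _ _ → refl)
      ... | inj₁ (k , _ , mix , _) = ⊥-elim (synced⇒¬mixed (clock-synced k) (to (Sat-mixed clock k) mix))
      ... | inj₂ sat' = from (⊨ₛ⇔clock d) (clock-tef nonempty , to (embed-faithful T d clock-synced) sat')

-- The translation into ∀TeamCTL with inclusion atoms.

module ∀CTL {AP : Set} where

  mixed : Formula (Maybe AP)
  mixed = (pos nothing ∷ []) ⊆ (neg nothing ∷ [])

  con temp : Formula (Maybe AP) → Formula (Maybe AP)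
  con F  = mixed or F
  temp F = quant all F

  open Translation con temp public

  con-fragment : ∀ {F} → TeamCTL ｛ all ｝ ｛ incl ｝ F → TeamCTL ｛ all ｝ ｛ incl ｝ (con F)
  con-fragment = or′ (incl′ refl)

  fragment : ∀ {φ} (d : TeamLTL ∅ φ) → TeamCTL ｛ all ｝ ｛ incl ｝ (translate d)
  fragment (pos′ p)   = con-fragment (pos′ (just p))
  fragment (neg′ p)   = con-fragment (neg′ (just p))
  fragment (or′ d e)  = con-fragment (or′ (fragment d) (fragment e))
  fragment (and′ d e) = con-fragment (and′ (fragment d) (fragment e))
  fragment (X′ d)     = con-fragment (X′ refl (fragment d))
  fragment (U′ d e)   = con-fragment (U′ refl (fragment d) (fragment e))
  fragment (W′ d e)   = con-fragment (W′ refl (fragment d) (fragment e))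

  module _ (em : ExcludedMiddle 0ℓ) (T : Team AP) where
    open Semantics T
    open Synchrony T
    open Correctness T
    open Semantics (T ₒ) using () renaming (Sat to Satₒ)

    Sat-mixed : ∀ {V τ i} → Mixed V τ i → Satₒ V τ i mixed
    Sat-mixed {V} {τ} {i} ((t₁ , t₁∈V , e₁) , (t₂ , t₂∈V , e₂)) t t∈V with even (τ i t) in e
    ... | true  = t₂ , t₂∈V , λ { zero → trans e (cong not (sym e₂)) }
    ... | false = t₁ , t₁∈V , λ { zero → trans e (cong not (sym e₁)) }

    mixed⇒empty : ∀ {V τ i} → Synced V τ i → Satₒ V τ i mixed → Empty V
    mixed⇒empty {i = i} s sat t t∈V with sat t t∈V
    ... | t' , t'∈V , opposite = not-¬ {even i} refl
      (subst₂ (λ x y → even x ≡ not (even y)) (s i ≤-refl t t∈V) (s i ≤-refl t' t'∈V) (opposite zero))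

    -- The part satisfying `mixed` is empty, so the team lies inside the other part and downward
    -- closure transfers `φ` to it. Conversely `mixed` receives the empty part.
    con-faithful : ∀ F {φ} → TeamLTL ∅ φ → Faithful Synced F φ → Faithful Synced (con F) φ
    con-faithful F d f {V} {τ} {i} s = mk⇔
      (λ (V₁ , V₂ , part , mix , sat) → Sat-mono d
        (partition-emptyˡ part (mixed⇒empty {V₁} {τ} {i} (synced-⊑ (partition-⊑ˡ part) s) mix))
        (λ _ _ _ → refl)
        (to (f (synced-⊑ (partition-⊑ʳ part) s)) sat))
      (λ sat → (λ _ → false) , V , (λ _ → refl , refl) , (λ _ ()) , from (f s) sat)

    -- The whole team goes to `mixed`, so `F` is needed only on an empty part. One is obtained by
    -- applying faithfulness to the empty team, where any `τ` is vacuously synchronous and `φ`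
    -- holds.
    mixed⇒con : ∀ F {φ V τ i} → TeamLTL ∅ φ → Faithful Synced (con F) φ →
                Mixed V τ i → Satₒ V τ i (con F)
    mixed⇒con F {V = V} {τ} {i} d f mix
      with from (f {λ _ → false} {τ} {i} (λ _ _ _ ())) (Sat-empty d ∅-empty)
    -- V₂ is an empty team on which F holds.
    ... | V₁ , V₂ , part , _ , sat =
      V , V₂ , partition-with-empty (λ t → ∅-empty t ∘ partition-⊑ʳ {V₁ = V₁} part t)
        , Sat-mixed {V} {τ} {i} mix , sat

    uniform-or-mixed : ∀ V τ i → Uniform V τ i ⊎ Mixed V τ i
    uniform-or-mixed V τ i with em {Mixed V τ i}
    ... | yes mix   = inj₂ mix
    ... | no ¬mixed = inj₁ (¬mixed⇒uniform {V} {τ} {i} ¬mixed)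

    -- Dual to the existential case: the universal quantifier is instantiated with the clock, and on
    -- an empty team, where it says nothing, `φ` holds anyway.
    temp-faithful : ∀ F {φ} → TeamLTL ∅ φ →
      (∀ {V τ i} → Tef V τ → Synced V τ i → Sat V clock i φ → Satₒ V τ i F) →
      (∀ {V i} → Satₒ V clock i F → Sat V clock i φ) →
      Faithful Synced (temp F) φ
    temp-faithful F {φ} d there back {V} {τ} {i} s = mk⇔ (backward em)
      (λ sat τ' tef same →
        there tef (λ j j≤i t t∈V → trans (same j j≤i t t∈V) (s j j≤i t t∈V)) sat)
      where
      backward : Dec (Empty V) → Satₒ V τ i (temp F) → Sat V clock i φ
      backward (yes empty)   _   = Sat-empty d empty
      backward (no nonempty) sat =
        back (sat clock (clock-tef nonempty) (λ j j≤i t t∈V → sym (s j j≤i t t∈V)))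

    X-faithful : ∀ F {φ} → TeamLTL ∅ φ → Faithful Synced (con F) φ →
                 Faithful Synced (temp (X (con F))) (X φ)
    X-faithful F {φ} d f = temp-faithful (X (con F)) (X′ d) there
      (λ {_} {i} → to (f (clock-synced (suc i))))
      where
      there : ∀ {V τ i} → Tef V τ → Synced V τ i → Sat V clock i (X φ) → Satₒ V τ i (X (con F))
      there {V} {τ} {i} tef s sat with uniform-or-mixed V τ (suc i)
      ... | inj₁ uniform = from (f (advance tef s uniform)) sat
      ... | inj₂ mix     = mixed⇒con F d f mix

    U-faithful : ∀ F G {φ ψ} → TeamLTL ∅ φ → TeamLTL ∅ ψ →
                 Faithful Synced (con F) φ → Faithful Synced (con G) ψ →
                 Faithful Synced (temp (con F U con G)) (φ U ψ)
    U-faithful F G {φ} {ψ} d e f g = temp-faithful (con F U con G) (U′ d e) there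
      (λ (k , i≤k , satₖ , before) → k , i≤k , to (g (clock-synced k)) satₖ ,
        λ m i≤m m<k → to (f (clock-synced m)) (before m i≤m m<k))
      where
      there : ∀ {V τ i} → Tef V τ → Synced V τ i → Sat V clock i (φ U ψ) → Satₒ V τ i (con F U con G)
      there {V} {τ} tef s (k , i≤k , satₖ , before)
        with synced-until (λ m → Mixed V τ (suc m)) tef s k (λ m _ _ → uniform-or-mixed V τ (suc m))
      ... | inj₁ sₖ = k , i≤k , from (g sₖ) satₖ ,
        λ m i≤m m<k → from (f (synced-≤ (<⇒≤ m<k) sₖ)) (before m i≤m m<k)
      -- The first mixed time releases the `U` at `suc m ≤ k`; all earlier times are synchronous and
      -- lie before `k`.
      ... | inj₂ (m , i≤m , m<k , sₘ , mix) = suc m , m≤n⇒m≤1+n i≤m , mixed⇒con G e g mix ,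
        λ n i≤n n≤m → from (f (synced-≤ (s≤s⁻¹ n≤m) sₘ)) (before n i≤n (<-≤-trans n≤m m<k))

    W-faithful : ∀ F G {φ ψ} → TeamLTL ∅ φ → TeamLTL ∅ ψ →
                 Faithful Synced (con F) φ → Faithful Synced (con G) ψ →
                 Faithful Synced (temp (con F W con G)) (φ W ψ)
    W-faithful F G {φ} {ψ} d e f g = temp-faithful (con F W con G) (W′ d e) there
      (λ sat k i≤k → ⊎-map (to (f (clock-synced k)))
        (λ (m , i≤m , m≤k , satₘ) → m , i≤m , m≤k , to (g (clock-synced m)) satₘ) (sat k i≤k))
      where
      there : ∀ {V τ i} → Tef V τ → Synced V τ i → Sat V clock i (φ W ψ) → Satₒ V τ i (con F W con G)
      there {V} {τ} tef s sat k i≤k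
        with synced-until (λ m → Mixed V τ (suc m)) tef s k (λ m _ _ → uniform-or-mixed V τ (suc m))
      ... | inj₂ (m , i≤m , m<k , _ , mix) =
        inj₂ (suc m , m≤n⇒m≤1+n i≤m , m<k , mixed⇒con G e g mix)
      ... | inj₁ sₖ with sat k i≤k
      ...   | inj₁ satₖ = inj₁ (from (f sₖ) satₖ)
      ...   | inj₂ (m , i≤m , m≤k , satₘ) = inj₂ (m , i≤m , m≤k , from (g (synced-≤ m≤k sₖ)) satₘ)

    faithful : ∀ {φ} (d : TeamLTL ∅ φ) → Faithful Synced (translate d) φ
    faithful = translate-faithful Synced con temp synced-⊑ (λ {_} {_} {i} s → s i ≤-refl)
      con-faithful X-faithful U-faithful W-faithful

    correct : ∀ {φ} (d : TeamLTL ∅ φ) → NonEmpty T → (T ⊨ₛ φ) ⇔ (T ₒ ⊨∀ translate d)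
    correct d t₀ = mk⇔
      (λ sat τ tef init → from (faithful d (initial⇒synced init)) (proj₂ (to (⊨ₛ⇔clock d) sat)))
      (λ sat → from (⊨ₛ⇔clock d)
        (clock-tef nonempty , to (faithful d (clock-synced 0)) (sat clock (clock-tef nonempty) (λ _ _ → refl))))
      where
      nonempty : ¬ Empty {Index T} full
      nonempty empty = empty t₀ refl

-- The machines

fix : {AP : Set} → Token ⊤ → Token (Maybe AP)
fix = mapToken (λ _ → nothing)

inject : {AP : Set} → Token AP → Token (Maybe AP)
inject = mapToken just

forget : {AP : Set} → Token AP → Token ⊤
forget = mapToken (λ _ → tt)

drop-length-++ : ∀ {A : Set} (xs ys : List A) → drop (length xs) (xs ++ ys) ≡ ys
drop-length-++ []       ys = refl
drop-length-++ (x ∷ xs) ys = drop-length-++ xs ys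

drop-suc : ∀ {A : Set} n (xs : List A) {y r} → drop n xs ≡ y ∷ r → drop (suc n) xs ≡ r
drop-suc zero    (x ∷ xs) refl = refl
drop-suc (suc n) (x ∷ xs) e    = drop-suc n xs e

drop-cons⇒< : ∀ {A : Set} n (xs : List A) {y r} → drop n xs ≡ y ∷ r → n < length xs
drop-cons⇒< zero    (x ∷ xs) e = s≤s z≤n
drop-cons⇒< (suc n) (x ∷ xs) e = s≤s (drop-cons⇒< n xs e)

-- In prefix notation every context of a translation is a word inserted before a
-- subformula: outerʷ before the whole formula, conʷ before each subformula, and tempʷ
-- moreover before each temporal operator.  In state n, reading x, the machine prints
-- the rest of emitted x from position n on and then copies x.  It starts in state 0
-- and returns to state length outerʷ, except after a negation sign, where the last
-- state makes it copy the proposition without inserting anything.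
module Transducer (outerʷ conʷ tempʷ : List (Token ⊤)) where

  inserted emitted : Token ⊤ → List (Token ⊤)
  inserted (key kX) = conʷ ++ tempʷ
  inserted (key kU) = conʷ ++ tempʷ
  inserted (key kW) = conʷ ++ tempʷ
  inserted _        = conʷ
  emitted x = outerʷ ++ inserted x

  -- `last` is the length of the longest word `emitted x`, so in that state nothing remains to be
  -- inserted.
  ready last : ℕ
  ready = length outerʷ
  last  = ready + length (conʷ ++ tempʷ)

  after : Token ⊤ → ℕ
  after (key kneg) = last
  after _          = ready

  conʷ≤ : length conʷ ≤ length (conʷ ++ tempʷ)
  conʷ≤ = subst (length conʷ ≤_) (sym (length-++ conʷ)) (m≤m+n _ _)

  inserted≤ : ∀ x → length (inserted x) ≤ length (conʷ ++ tempʷ)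
  inserted≤ (prop _)         = conʷ≤
  inserted≤ (key kneg)       = conʷ≤
  inserted≤ (key kor)        = conʷ≤
  inserted≤ (key kand)       = conʷ≤
  inserted≤ (key kX)         = ≤-refl
  inserted≤ (key kU)         = ≤-refl
  inserted≤ (key kW)         = ≤-refl
  inserted≤ (key korᴮ)       = conʷ≤
  inserted≤ (key kNE)        = conʷ≤
  inserted≤ (key kincl)      = conʷ≤
  inserted≤ (key ksep)       = conʷ≤
  inserted≤ (key (kquant _)) = conʷ≤

  emitted≤last : ∀ x → length (emitted x) ≤ last
  emitted≤last x = subst (_≤ last) (sym (length-++ outerʷ)) (+-monoʳ-≤ ready (inserted≤ x))

  ready≤last : ready ≤ last
  ready≤last = m≤m+n _ _

  after≤last : ∀ x → after x ≤ last
  after≤last (prop _)         = ready≤last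
  after≤last (key kneg)       = ≤-refl
  after≤last (key kor)        = ready≤last
  after≤last (key kand)       = ready≤last
  after≤last (key kX)         = ready≤last
  after≤last (key kU)         = ready≤last
  after≤last (key kW)         = ready≤last
  after≤last (key korᴮ)       = ready≤last
  after≤last (key kNE)        = ready≤last
  after≤last (key kincl)      = ready≤last
  after≤last (key ksep)       = ready≤last
  after≤last (key (kquant _)) = ready≤last

  -- Truncation makes this total; every state reached is at most `last`, where `toℕ-at` undoes it.
  at : ℕ → Fin (suc last)
  at n = fromℕ< {n ⊓ last} (s≤s (m⊓n≤n n last))

  toℕ-at : ∀ {n} → n ≤ last → toℕ (at n) ≡ n
  toℕ-at {n} n≤last = trans (toℕ-fromℕ< (s≤s (m⊓n≤n n last))) (m≤n⇒m⊓n≡m n≤last)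

  act : ℕ → Token ⊤ → List (Token ⊤) → Action (suc last) 1
  act n x []      = action (at (after x)) (copy zero ∷ []) (R ∷ []) (copy zero)
  act n x (y ∷ _) = action (at (suc n)) (copy zero ∷ []) (S ∷ []) (fixed (just y))

  machine : Machine
  machine = record
    { states    = suc last
    ; workTapes = 0
    ; start     = zero
    ; δ         = λ { q (nothing ∷ []) → nothing
                    ; q (just x ∷ []) → just (act (toℕ q) x (drop (toℕ q) (emitted x))) } }

  -- Runs of the transducer: output and running time.

  module _ {AP : Set} where
    open Execution machine {AP}

    reading : List (Cell AP) → List (Token AP) → Tape AP
    reading ls []       = tape ls nothing []
    reading ls (x ∷ xs) = tape ls (just x) (map just xs)

    move-reading : ∀ ls x xs → move R (reading ls (x ∷ xs)) ≡ reading (just x ∷ ls) xs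
    move-reading ls x []       = refl
    move-reading ls x (_ ∷ xs) = refl

    load-reading : ∀ xs → load xs ≡ reading [] xs
    load-reading []       = refl
    load-reading (x ∷ xs) = refl

    run : ℕ → List (Token AP) → List (Token (Maybe AP))
    run n []       = []
    run n (x ∷ xs) = map fix (drop n (emitted (forget x))) ++ inject x ∷ run (after (forget x)) xs

    here : ℕ → List (Cell AP) → List (Token AP) → Config
    here n ls xs = config (at n) (reading ls xs ∷ [])

    -- Induction on the word `r` still to be inserted: each of its tokens costs one step with the
    -- head at rest, and one more step copies `x` and moves right.
    emit : ∀ {k w} n ls x xs r → n ≤ last → drop n (emitted (forget x)) ≡ r →
           Halts (here (after (forget x)) (just x ∷ ls) xs) k w →
           Halts (here n ls (x ∷ xs)) (length r + suc k) (map fix r ++ inject x ∷ w)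
    emit {k} {w} n ls x xs [] n≤last e halts = step
      (cong just (trans (cong (λ j → act j (forget x) (drop j (emitted (forget x)))) (toℕ-at n≤last))
                        (cong (act n (forget x)) e)))
      (subst (λ t → Halts (config (at (after (forget x))) (t ∷ [])) k w) (sym (move-reading ls x xs)) halts)
    emit n ls x xs (y ∷ r) n≤last e halts = step
      (cong just (trans (cong (λ j → act j (forget x) (drop j (emitted (forget x)))) (toℕ-at n≤last))
                        (cong (act n (forget x)) e)))
      (emit (suc n) ls x xs r
        (≤-trans (drop-cons⇒< n (emitted (forget x)) e) (emitted≤last (forget x)))
        (drop-suc n (emitted (forget x)) e) halts)

    -- Each input token costs at most `last` insertions and one copying step, which gives the factor
    -- `suc last`.
    run-halts : ∀ n ls xs → n ≤ last →
                ∃[ k ] k ≤ suc last * length xs × Halts (here n ls xs) k (run n xs)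
    run-halts n ls []       n≤last = 0 , z≤n , halt refl
    run-halts n ls (x ∷ xs) n≤last
      with run-halts (after (forget x)) (just x ∷ ls) xs (after≤last (forget x))
    ... | k , k≤ , halts = _ , bound , emit n ls x xs _ n≤last refl halts
      where
      rest = drop n (emitted (forget x))

      rest≤last : length rest ≤ last
      rest≤last = ≤-trans (≤-reflexive (length-drop n (emitted (forget x))))
                          (≤-trans (m∸n≤m _ n) (emitted≤last (forget x)))

      bound : length rest + suc k ≤ suc last * suc (length xs)
      bound = begin
        length rest + suc k                ≤⟨ +-mono-≤ rest≤last (s≤s k≤) ⟩
        last + suc (suc last * length xs)  ≡⟨ +-suc last _ ⟩
        suc last + suc last * length xs    ≡⟨ sym (*-suc (suc last) (length xs)) ⟩
        suc last * suc (length xs)         ∎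
        where open ≤-Reasoning

    run-ready : ∀ x xs →
      run ready (x ∷ xs) ≡ map fix (inserted (forget x)) ++ inject x ∷ run (after (forget x)) xs
    run-ready x xs = cong (λ l → map fix l ++ inject x ∷ run (after (forget x)) xs)
                          (drop-length-++ outerʷ (inserted (forget x)))

    run-start : ∀ x xs → run 0 (x ∷ xs) ≡ map fix outerʷ ++ run ready (x ∷ xs)
    run-start x xs = begin
      map fix (outerʷ ++ inserted (forget x)) ++ tail
        ≡⟨ cong (_++ tail) (map-++ fix outerʷ _) ⟩
      (map fix outerʷ ++ map fix (inserted (forget x))) ++ tail
        ≡⟨ ++-assoc (map fix outerʷ) _ _ ⟩
      map fix outerʷ ++ map fix (inserted (forget x)) ++ tail
        ≡⟨ cong (map fix outerʷ ++_) (sym (run-ready x xs)) ⟩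
      map fix outerʷ ++ run ready (x ∷ xs) ∎
      where
      open ≡-Reasoning
      tail = inject x ∷ run (after (forget x)) xs

    run-last : ∀ x xs → run last (x ∷ xs) ≡ inject x ∷ run (after (forget x)) xs
    run-last x xs = cong (λ l → map fix l ++ inject x ∷ run (after (forget x)) xs)
                         (drop-all last (emitted (forget x)) (emitted≤last (forget x)))

    -- The arbitrary continuation `ys`, met again in state `ready`, makes the relation compatible
    -- with concatenation.
    record Turns_into_ (w : List (Token AP)) (w' : List (Token (Maybe AP))) : Set where
      constructor turning
      field turned : ∀ ys → run ready (w ++ ys) ≡ w' ++ run ready ys
    open Turns_into_ public

    turns-++ : ∀ {u u' v v'} → Turns u into u' → Turns v into v' → Turns (u ++ v) into (u' ++ v')
    turned (turns-++ {u} {u'} {v} {v'} p q) ys = begin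
      run ready ((u ++ v) ++ ys)  ≡⟨ cong (run ready) (++-assoc u v ys) ⟩
      run ready (u ++ v ++ ys)    ≡⟨ turned p (v ++ ys) ⟩
      u' ++ run ready (v ++ ys)   ≡⟨ cong (u' ++_) (turned q ys) ⟩
      u' ++ v' ++ run ready ys    ≡⟨ sym (++-assoc u' v' _) ⟩
      (u' ++ v') ++ run ready ys  ∎
      where open ≡-Reasoning

    turns-∷ : ∀ x {w w'} → after (forget x) ≡ ready → Turns w into w' →
              Turns (x ∷ w) into (map fix (inserted (forget x)) ++ inject x ∷ w')
    turned (turns-∷ x {w} {w'} e p) ys = begin
      run ready (x ∷ w ++ ys)
        ≡⟨ run-ready x (w ++ ys) ⟩
      u ++ inject x ∷ run (after (forget x)) (w ++ ys)
        ≡⟨ cong (λ n → u ++ inject x ∷ run n (w ++ ys)) e ⟩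
      u ++ inject x ∷ run ready (w ++ ys)
        ≡⟨ cong (λ l → u ++ inject x ∷ l) (turned p ys) ⟩
      u ++ inject x ∷ w' ++ run ready ys
        ≡⟨ sym (++-assoc u (inject x ∷ w') _) ⟩
      (u ++ inject x ∷ w') ++ run ready ys ∎
      where
      open ≡-Reasoning
      u = map fix (inserted (forget x))

    -- Both tokens are treated at once because the state between them is `last`: the negated
    -- proposition must not receive a `conʷ` of its own.
    turns-neg : ∀ p → Turns (key kneg ∷ prop p ∷ []) into (map fix conʷ ++ key kneg ∷ prop (just p) ∷ [])
    turned (turns-neg p) ys = begin
      run ready (key kneg ∷ prop p ∷ ys)
        ≡⟨ run-ready (key kneg) (prop p ∷ ys) ⟩
      map fix conʷ ++ key kneg ∷ run last (prop p ∷ ys)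
        ≡⟨ cong (λ l → map fix conʷ ++ key kneg ∷ l) (run-last (prop p) ys) ⟩
      map fix conʷ ++ key kneg ∷ prop (just p) ∷ run ready ys
        ≡⟨ sym (++-assoc (map fix conʷ) _ _) ⟩
      (map fix conʷ ++ key kneg ∷ prop (just p) ∷ []) ++ run ready ys ∎
      where open ≡-Reasoning

-- From translations to linear-time constructions.

code-nonempty : ∀ {AP} {φ : Formula AP} → TeamLTL ∅ φ → ∃[ x ] ∃[ xs ] code φ ≡ x ∷ xs
code-nonempty (pos′ p)   = _ , _ , refl
code-nonempty (neg′ p)   = _ , _ , refl
code-nonempty (or′ d e)  = _ , _ , refl
code-nonempty (and′ d e) = _ , _ , refl
code-nonempty (X′ d)     = _ , _ , refl
code-nonempty (U′ d e)   = _ , _ , refl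
code-nonempty (W′ d e)   = _ , _ , refl

module Construction
  (outer con temp : ∀ {AP} → Formula (Maybe AP) → Formula (Maybe AP))
  (outerʷ conʷ tempʷ : List (Token ⊤))
  (code-outer : ∀ {AP} (F : Formula (Maybe AP)) → code (outer F) ≡ map fix outerʷ ++ code F)
  (code-con : ∀ {AP} (F : Formula (Maybe AP)) → code (con F) ≡ map fix conʷ ++ code F)
  (code-temp : ∀ {AP} (F : Formula (Maybe AP)) → code (temp F) ≡ map fix tempʷ ++ code F)
  where
  open Transducer outerʷ conʷ tempʷ

  module _ {AP : Set} where
    open Translation {AP} con temp

    code-con-temp : (F : Formula (Maybe AP)) → code (con (temp F)) ≡ map fix (conʷ ++ tempʷ) ++ code F
    code-con-temp F = begin
      code (con (temp F))                          ≡⟨ code-con (temp F) ⟩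
      map fix conʷ ++ code (temp F)                ≡⟨ cong (map fix conʷ ++_) (code-temp F) ⟩
      map fix conʷ ++ map fix tempʷ ++ code F      ≡⟨ sym (++-assoc (map fix conʷ) _ _) ⟩
      (map fix conʷ ++ map fix tempʷ) ++ code F    ≡⟨ cong (_++ code F) (sym (map-++ fix conʷ tempʷ)) ⟩
      map fix (conʷ ++ tempʷ) ++ code F            ∎
      where open ≡-Reasoning

    turns : ∀ {φ} (d : TeamLTL ∅ φ) → Turns (code φ) into (code (translate d))
    turns d@(pos′ p)   rewrite code-con (body d) = turns-∷ (prop p) refl (turning λ _ → refl)
    turns d@(neg′ p)   rewrite code-con (body d) = turns-neg p
    turns d@(or′ e f)  rewrite code-con (body d) = turns-∷ (key kor) refl (turns-++ (turns e) (turns f))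
    turns d@(and′ e f) rewrite code-con (body d) = turns-∷ (key kand) refl (turns-++ (turns e) (turns f))
    turns (X′ e)   rewrite code-con-temp (X (translate e)) = turns-∷ (key kX) refl (turns e)
    turns (U′ e f) rewrite code-con-temp (translate e U translate f) =
      turns-∷ (key kU) refl (turns-++ (turns e) (turns f))
    turns (W′ e f) rewrite code-con-temp (translate e W translate f) =
      turns-∷ (key kW) refl (turns-++ (turns e) (turns f))

    run-code : ∀ {φ} (d : TeamLTL ∅ φ) → run 0 (code φ) ≡ code (outer (translate d))
    -- A first token is exposed because `outerʷ` is printed only when one is read.
    run-code {φ} d with code φ | code-nonempty d | turns d
    ... | _ | x , xs , refl | t = begin
      run 0 (x ∷ xs)                                        ≡⟨ run-start x xs ⟩
      map fix outerʷ ++ run ready (x ∷ xs)                  ≡⟨ cong ((map fix outerʷ ++_) ∘ run ready) (sym (++-identityʳ (x ∷ xs))) ⟩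
      map fix outerʷ ++ run ready ((x ∷ xs) ++ [])          ≡⟨ cong (map fix outerʷ ++_) (turned t []) ⟩
      map fix outerʷ ++ code (translate d) ++ []            ≡⟨ cong (map fix outerʷ ++_) (++-identityʳ _) ⟩
      map fix outerʷ ++ code (translate d)                  ≡⟨ sym (code-outer (translate d)) ⟩
      code (outer (translate d))                            ∎
      where open ≡-Reasoning

  construct : {P : ∀ {AP} → Formula AP → Formula (Maybe AP) → Set₁} →
    (∀ {AP} {φ : Formula AP} (d : TeamLTL ∅ φ) → P φ (outer (Translation.translate con temp d))) →
    LinearTimeConstruction P
  construct correct = machine , suc last , λ φ d →
    let k , k≤ , halts = run-halts 0 [] (code φ) z≤n
    in outer (Translation.translate con temp d) , k , k≤
     , subst₂ (λ t w → Execution.Halts machine (Execution.config zero (t ∷ [])) k w)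
              (sym (load-reading (code φ))) (run-code d) halts
     , correct d

lemma4p2 : ExcludedMiddle 0ℓ →
    LinearTimeConstruction (λ {AP} φ φ⁺ →
    TeamLTL ∅ φ⁺ × ((T : Team AP) → (T ⊨ₛ φ) ⇔ (T ₒ ⊨∃ φ⁺)))
    × LinearTimeConstruction (λ {AP} φ φ⁺ →
    TeamCTL ｛ some ｝ ｛ ∨B ｝ φ⁺ × ((T : Team AP) → (T ⊨ₛ φ) ⇔ (T ₒ ⊨∃ φ⁺)))
    × LinearTimeConstruction (λ {AP} φ φ⁻ →
    TeamLTL (｛ ∨B ｝ ∪ ｛ ne ｝) φ⁻ × ((T : Team AP) → NonEmpty T → (T ⊨ₛ φ) ⇔ (T ₒ ⊨∀ φ⁻)))
    × LinearTimeConstruction (λ {AP} φ φ⁻ →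
    TeamCTL ｛ all ｝ ｛ incl ｝ φ⁻ × ((T : Team AP) → NonEmpty T → (T ⊨ₛ φ) ⇔ (T ₒ ⊨∀ φ⁻)))
lemma4p2 em =
    -- Each word below is the prefix code of a context up to its last argument, which is the hole;
    -- hence the three code equations hold by computation.
    Construction.construct ∃LTL.outer id id
      (key kand ∷ key kW ∷ key kor ∷ key kand ∷ o ∷ key kX ∷ key kneg ∷ o
        ∷ key kand ∷ key kneg ∷ o ∷ key kX ∷ o ∷ key kand ∷ o ∷ key kneg ∷ o ∷ [])
      [] [] (λ _ → refl) (λ _ → refl) (λ _ → refl)
      (λ d → ∃LTL.fragment d , λ T → ∃LTL.correct T d)
  , Construction.construct id ∃CTL.con ∃CTL.temp []
      (key kand ∷ key korᴮ ∷ o ∷ key kneg ∷ o ∷ [])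
      (key korᴮ ∷ key kand ∷ o ∷ key kneg ∷ o ∷ key (kquant some) ∷ [])
      (λ _ → refl) (λ _ → refl) (λ _ → refl)
      (λ d → ∃CTL.fragment d , λ T → ∃CTL.correct em T d)
  , Construction.construct ∀LTL.outer id id
      (key korᴮ ∷ key kU ∷ key kor ∷ o ∷ key kneg ∷ o
        ∷ key kor ∷ key kand ∷ key kNE ∷ o ∷ key kand ∷ key kNE ∷ key kneg ∷ o ∷ [])
      [] [] (λ _ → refl) (λ _ → refl) (λ _ → refl)
      (λ d → ∀LTL.fragment d , λ T → ∀LTL.correct em T d)
  , Construction.construct id ∀CTL.con ∀CTL.temp []
      (key kor ∷ key kincl ∷ o ∷ key ksep ∷ key kneg ∷ o ∷ key ksep ∷ [])
      (key (kquant all) ∷ [])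
      (λ _ → refl) (λ _ → refl) (λ _ → refl)
      (λ d → ∀CTL.fragment d , λ T → ∀CTL.correct em T d)
  where
  o : Token ⊤
  o = prop tt
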